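{- For every integer $n \geq 3$ and every graph $H \in \mathcal{F}(n)$, there is $k \in \mathbb{N}$ such that the graph $\square^n K_k$ is $H$-induced-saturated.
   Context: All graphs are finite and simple; $\mathbb{N}=\{1,2,\dots\}$. For graphs $H,G$, write $H \subseteq_I G$ if $G$ contains an induced subgraph isomorphic to $H$. A graph $G$ on at least two vertices is $H$-induced-saturated if $H \not\subseteq_I G$, but $H \subseteq_I G - e$ for every edge $e \in E(G)$ and $H \subseteq_I G + e$ for every edge $e \in E(\overline{G})$ of the complement. $\square^n K_k$ is the Cartesian product of $n$ cliques of order $k$: its vertices are all $n$-tuples with entries in a fixed $k$-element set, two tuples being adjacent iff they differ in exactly one coordinate. The dimension $\dim(G)$ of a graph $G$ is the smallest integer $n$ such that $G \subseteq_I \square^n K_k$ for some $k \in \mathbb{N}$ (and is infinite if no such $n$ exists). A balanced $p$-legged spider of height $q$ is a union of $p$ paths $L_1,\dots,L_p$, each of length $q$ (i.e. with $q$ edges), that share exactly one vertex $r$, which is an endpoint of each of them, with $V(L_i)\cap V(L_j)=\{r\}$ for all $1 \le i<j \le p$; its vertices of degree $1$ are called leaves. For $n \geq 3$, $\mathcal{F}(n)$ is the class of graphs $H$ that can be obtained as the union $H = F \cup T$ of graphs $F$ and $T$ such that $\dim(F) \leq n-1$, $T$ is a balanced $(n+1)$-legged spider of height $n+2$, and $V(F) \cap V(T) = V'$, where $V'$ is the set of leaves of $T$. -}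

module Defs where

open import Data.Nat using (ℕ; zero; suc; _+_; _∸_; _^_; _≤_; _≥_)
open import Data.Fin using (Fin; zero; suc; inject₁)
import Data.Fin.Properties as Fin
open import Data.Vec using (Vec; []; _∷_; lookup)
open import Data.Product using (∃; ∃!; _×_; _,_; swap)
open import Data.Product.Function.NonDependent.Propositional using (_×-↔_)
open import Data.Sum using (_⊎_; inj₁; inj₂; [_,_]′)
import Data.Sum as Sum
open import Function.Base using (_∘_)
open import Function.Bundles using (_↔_; mk↔ₛ′; _⇔_)
open import Function.Definitions using (Injective)
open import Function.Properties.Inverse using (↔⇒↣; ↔-sym; ↔-refl; ↔-trans)
open import Relation.Binary.Definitions
  using (Decidable; DecidableEquality; Symmetric; Irreflexive)
open import Relation.Binary.PropositionalEquality
  using (_≡_; _≢_; refl; sym; ≢-sym)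
open import Relation.Nullary using (¬_; Dec)
open import Relation.Nullary.Decidable
  using (map′; ¬?; _×-dec_; _⊎-dec_; _→-dec_)
import Relation.Unary as U

-- Finite simple graphs.  Adjacency is decidable, as it is for every finite
-- graph classically.
record Graph : Set₁ where
  field
    V      : Set
    order  : ℕ
    finite : V ↔ Fin order
    Adj    : V → V → Set
    adj?   : Decidable Adj
    symm   : Symmetric Adj
    irrefl : Irreflexive _≡_ Adj

  _≟ᵛ_ : DecidableEquality V
  _≟ᵛ_ = Fin.inj⇒≟ (↔⇒↣ finite)

open Graph public using (V; order; Adj; symm; irrefl)

-- {x , y} = {u , v} as unordered pairs.
SamePair : {A : Set} → A → A → A → A → Set
SamePair x y u v = (x ≡ u × y ≡ v) ⊎ (x ≡ v × y ≡ u)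

samePair-swap : {A : Set} {x y u v : A} → SamePair x y u v → SamePair y x u v
samePair-swap = [ inj₂ ∘ swap , inj₁ ∘ swap ]′

samePair? : {A : Set} → DecidableEquality A → (x y u v : A) → Dec (SamePair x y u v)
samePair? _≟_ x y u v = ((x ≟ u) ×-dec (y ≟ v)) ⊎-dec ((x ≟ v) ×-dec (y ≟ u))

complement : Graph → Graph
complement G = record
  { V      = V G
  ; order  = order G
  ; finite = Graph.finite G
  ; Adj    = λ x y → x ≢ y × ¬ Adj G x y
  ; adj?   = λ x y → ¬? (Graph._≟ᵛ_ G x y) ×-dec ¬? (Graph.adj? G x y)
  ; symm   = λ (x≢y , ¬xy) → ≢-sym x≢y , ¬xy ∘ symm G
  ; irrefl = λ x≡y (x≢y , _) → x≢y x≡y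
  }

-- Only the fact that uv is an edge, not which proof of it is given, plays a
-- role; likewise in addEdge.
deleteEdge : (G : Graph) (u v : V G) → Adj G u v → Graph
deleteEdge G u v _ = record
  { V      = V G
  ; order  = order G
  ; finite = Graph.finite G
  ; Adj    = λ x y → Adj G x y × ¬ SamePair x y u v
  ; adj?   = λ x y → Graph.adj? G x y ×-dec ¬? (samePair? (Graph._≟ᵛ_ G) x y u v)
  ; symm   = λ (xy , ≠e) → symm G xy , ≠e ∘ samePair-swap
  ; irrefl = λ x≡y (xy , _) → irrefl G x≡y xy
  }

addEdge : (G : Graph) (u v : V G) → Adj (complement G) u v → Graph
addEdge G u v (u≢v , _) = record
  { V      = V G
  ; order  = order G
  ; finite = Graph.finite G
  ; Adj    = λ x y → Adj G x y ⊎ SamePair x y u v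
  ; adj?   = λ x y → Graph.adj? G x y ⊎-dec samePair? (Graph._≟ᵛ_ G) x y u v
  ; symm   = Sum.map (symm G) samePair-swap
  ; irrefl = λ where
      x≡y  (inj₁ xy)                  → irrefl G x≡y xy
      refl (inj₂ (inj₁ (refl , x≡v))) → u≢v x≡v
      refl (inj₂ (inj₂ (refl , x≡u))) → u≢v (sym x≡u)
  }

infix 4 _⊆ᴵ_

record _⊆ᴵ_ (H G : Graph) : Set where
  field
    embed     : V H → V G
    injective : Injective _≡_ _≡_ embed
    induced   : ∀ x y → Adj H x y ⇔ Adj G (embed x) (embed y)

record InducedSaturated (H G : Graph) : Set where
  field
    nontrivial : order G ≥ 2
    avoids     : ¬ (H ⊆ᴵ G)
    deletion   : ∀ u v (e : Adj G u v) → H ⊆ᴵ deleteEdge G u v e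
    addition   : ∀ u v (e : Adj (complement G) u v) → H ⊆ᴵ addEdge G u v e

DifferInOne : {A : Set} {n : ℕ} → Vec A n → Vec A n → Set
DifferInOne u v = ∃! _≡_ λ i → lookup u i ≢ lookup v i

∃!? : ∀ {n} {P : Fin n → Set} → U.Decidable P → Dec (∃! _≡_ P)
∃!? P? = map′ (λ (i , p , uniq) → i , p , λ {j} → uniq j)
              (λ (i , p , uniq) → i , p , λ _ → uniq)
              (Fin.any? λ i → P? i ×-dec Fin.all? λ j → P? j →-dec (i Fin.≟ j))

Vec-finite : ∀ n k → Vec (Fin k) n ↔ Fin (k ^ n)
Vec-finite zero k =
  mk↔ₛ′ (λ _ → zero) (λ _ → []) (λ { zero → refl }) (λ { [] → refl })
Vec-finite (suc n) k =
  ↔-trans uncons (↔-trans (↔-refl ×-↔ Vec-finite n k) (↔-sym Fin.*↔×))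
  where
  uncons : Vec (Fin k) (suc n) ↔ (Fin k × Vec (Fin k) n)
  uncons = mk↔ₛ′ (λ { (x ∷ xs) → x , xs }) (λ (x , xs) → x ∷ xs)
                 (λ _ → refl) (λ { (_ ∷ _) → refl })

□^_K_ : ℕ → ℕ → Graph
□^ n K k = record
  { V      = Vec (Fin k) n
  ; order  = k ^ n
  ; finite = Vec-finite n k
  ; Adj    = DifferInOne
  ; adj?   = λ u v → ∃!? λ i → ¬? (lookup u i Fin.≟ lookup v i)
  ; symm   = λ (i , u≢v , uniq) → i , ≢-sym u≢v , λ v≢u → uniq (≢-sym v≢u)
  ; irrefl = λ { refl (_ , u≢u , _) → u≢u refl }
  }

EmbedsInDimension : Graph → ℕ → Set
EmbedsInDimension G d = ∃ λ k → k ≥ 1 × G ⊆ᴵ □^ d K k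

-- dim(G) = d.  No d satisfies this when the dimension of G is infinite.
HasDimension : Graph → ℕ → Set
HasDimension G d =
  EmbedsInDimension G d × (∀ m → EmbedsInDimension G m → d ≤ m)

DimensionAtMost : Graph → ℕ → Set
DimensionAtMost G m = ∃ λ d → HasDimension G d × d ≤ m

-- T is a union of p paths with q edges each, pairwise meeting exactly in the
-- root; leg i visits the vertices leg i 0, …, leg i q in this order.
record IsBalancedSpider (p q : ℕ) (T : Graph) : Set where
  field
    root      : V T
    leg       : Fin p → Fin (suc q) → V T
    leg-path  : ∀ i → Injective _≡_ _≡_ (leg i)
    leg-start : ∀ i → leg i zero ≡ root
    disjoint  : ∀ i j → i ≢ j → ∀ a b → leg i a ≡ leg j b → leg i a ≡ root
    vertices  : ∀ x → ∃ λ i → ∃ λ a → x ≡ leg i a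
    edges     : ∀ x y → Adj T x y ⇔
                (∃ λ i → ∃ λ (a : Fin q) → SamePair x y (leg i (inject₁ a)) (leg i (suc a)))

-- Vertices of degree 1.
IsLeaf : (T : Graph) → V T → Set
IsLeaf T x = ∃! _≡_ (Adj T x)

-- H = F ∪ T, where the inclusions of the vertex sets of F and T into that of H
-- are explicit maps and V(F) ∩ V(T) is the set of vertices of T satisfying P.
record IsUnion (F T : Graph) (P : V T → Set) (H : Graph) : Set where
  field
    ιF           : V F → V H
    ιT           : V T → V H
    ιF-injective : Injective _≡_ _≡_ ιF
    ιT-injective : Injective _≡_ _≡_ ιT
    vertices     : ∀ x → (∃ λ f → x ≡ ιF f) ⊎ (∃ λ t → x ≡ ιT t)
    intersection : ∀ t → (∃ λ f → ιF f ≡ ιT t) ⇔ P t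
    edges        : ∀ x y → Adj H x y ⇔
                   ( (∃ λ f → ∃ λ g → Adj F f g × x ≡ ιF f × y ≡ ιF g)
                   ⊎ (∃ λ s → ∃ λ t → Adj T s t × x ≡ ιT s × y ≡ ιT t))

-- The class is meant for n ≥ 3.
record 𝓕 (n : ℕ) (H : Graph) : Set₁ where
  field
    F T      : Graph
    F-dim    : DimensionAtMost F (n ∸ 1)
    T-spider : IsBalancedSpider (n + 1) (n + 2) T
    union    : IsUnion F T (IsLeaf T) H

module Submission where

-- A vertex of □^ n K k has no n + 1 pairwise non-adjacent neighbours, since two of
-- them would differ from it in the same coordinate; the root of H has, so H is not
-- induced in □^ n K k.
--
-- Deleting uv, where u and v differ in coordinate d, gives n + 1 independent
-- neighbours to a vertex on the line through u and v: these two and one in each other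
-- direction.  Adding uv gives them to u: v and one in each direction.  In both cases F
-- is put into a hyperplane in which coordinate j is constant, using colours (tones)
-- that do not occur elsewhere.  Each leg owns a private colour.  After its second step
-- from the root it carries this colour in coordinate j and in a further coordinate, its
-- pivot; then the coordinates are replaced by those of its leaf one by one, the pivot
-- last but one and j last.  So two vertices on different legs differ both in j and in
-- one of the pivots, except for the last vertices before the leaves, which differ in j
-- and as their leaves do.  Permuting the colours in each coordinate moves this
-- configuration to the given u and v.

open import Defs
open import Data.Nat using (ℕ; suc; _+_; _^_; _≤_; _<_; _≥_; z≤n; s≤s; s≤s⁻¹; _<?_; _≤′_; ≤′-reflexive; ≤′-step)
open import Data.Nat.Properties as ℕ using (≤⇒≤′)
open import Data.Fin using (Fin; zero; suc; toℕ; inject₁; fromℕ; fromℕ<; punchIn; punchOut; join; splitAt)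
open import Data.Fin.Properties as Fin using (_≟_; any?)
open import Data.Fin.Permutation as Perm using (Permutation′; _⟨$⟩ʳ_; _⟨$⟩ˡ_; _∘ₚ_; transpose)
open import Data.Fin.Relation.Unary.Top using (View; view; view-inject₁; ‵fromℕ; ‵inject₁)
open import Data.Vec using (Vec; _∷_; lookup; tabulate; map; insertAt)
open import Data.Vec.Properties using (lookup∘tabulate; tabulate∘lookup; tabulate-cong; lookup-map;
  ∷-injective; insertAt-lookup; insertAt-punchIn)
open import Data.Product using (∃; ∃!; _×_; _,_; proj₁; proj₂)
open import Data.Sum using (_⊎_; inj₁; inj₂; [_,_]′; swap)
open import Data.Empty using (⊥; ⊥-elim)
open import Data.Unit using (⊤; tt)
open import Function.Base using (id; _∘_; _$_; case_of_)
open import Function.Bundles using (_⇔_; mk⇔; Equivalence)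
open import Function.Definitions using (Injective)
open import Relation.Binary.Definitions using (DecidableEquality; tri<; tri≈; tri>)
open import Relation.Binary.PropositionalEquality
  using (_≡_; _≢_; refl; sym; trans; cong; subst; subst₂; ≢-sym)
open import Relation.Nullary using (¬_; yes; no; contradiction)
open import Relation.Nullary.Decidable using (¬?; _×-dec_; decidable-stable; dec-true; dec-false)

open Equivalence using (to; from)

-- Tuples that differ in exactly one coordinate

Apart : {A : Set} {n : ℕ} → (Fin n → A) → (Fin n → A) → Set
Apart f g = ∃ λ x → f x ≢ g x

-- `DifferInOne` for tuples given as functions, the form in which colour tuples are kept until they
-- become vertices.
DiffOne : {A : Set} {n : ℕ} → (Fin n → A) → (Fin n → A) → Set
DiffOne f g = ∃! _≡_ λ x → f x ≢ g x

diffOne-at : ∀ {A : Set} {n} {f g : Fin n → A} x → f x ≢ g x →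
             (∀ y → y ≢ x → f y ≡ g y) → DiffOne f g
diffOne-at x fx≢gx same = x , fx≢gx , λ {y} fy≢gy →
  sym (decidable-stable (y ≟ x) (fy≢gy ∘ same y))

¬diffOne : ∀ {A : Set} {n} {f g : Fin n → A} x y → x ≢ y →
           f x ≢ g x → f y ≢ g y → ¬ DiffOne f g
¬diffOne x y x≢y fx≢ fy≢ (z , _ , unique) = x≢y (trans (sym (unique fx≢)) (unique fy≢))

diffOne-map : ∀ {A B : Set} {n} {f g : Fin n → A} {f′ g′ : Fin n → B} →
              (∀ x → f x ≢ g x → f′ x ≢ g′ x) → (∀ x → f′ x ≢ g′ x → f x ≢ g x) →
              DiffOne f g → DiffOne f′ g′
diffOne-map there back (x , fx≢ , unique) = x , there x fx≢ , λ {y} d → unique (back y d)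

diffOne-sym : ∀ {A : Set} {n} {f g : Fin n → A} → DiffOne f g → DiffOne g f
diffOne-sym = diffOne-map (λ _ → ≢-sym) (λ _ → ≢-sym)

lookup-ext : ∀ {A : Set} {n} {u v : Vec A n} → (∀ x → lookup u x ≡ lookup v x) → u ≡ v
lookup-ext {u = u} {v} eq =
  trans (sym (tabulate∘lookup u)) (trans (tabulate-cong eq) (tabulate∘lookup v))

-- Permutations with two prescribed values, and the colours they move

transpose-left : ∀ {n} (x y : Fin n) → transpose x y ⟨$⟩ʳ x ≡ y
transpose-left x y rewrite dec-true (x ≟ x) refl = refl

transpose-fix : ∀ {n} (x y z : Fin n) → z ≢ x → z ≢ y → transpose x y ⟨$⟩ʳ z ≡ z
transpose-fix x y z z≢x z≢y rewrite dec-false (z ≟ x) z≢x | dec-false (z ≟ y) z≢y = refl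

perm-injective : ∀ {n} (π : Permutation′ n) {x y} → π ⟨$⟩ʳ x ≡ π ⟨$⟩ʳ y → x ≡ y
perm-injective π eq = trans (sym (Perm.inverseˡ π)) (trans (cong (π ⟨$⟩ˡ_) eq) (Perm.inverseˡ π))

-- The first transposition settles `x`. The second sends the image of `x′` to `y′` and fixes `y`,
-- which is neither of the points it swaps.
prescribe : ∀ {n} {x x′ y y′ : Fin n} → x ≢ x′ → y ≢ y′ →
            ∃ λ (π : Permutation′ n) → π ⟨$⟩ʳ x ≡ y × π ⟨$⟩ʳ x′ ≡ y′
prescribe {x = x} {x′} {y} {y′} x≢x′ y≢y′ = π₁ ∘ₚ π₂ , fixes , transpose-left (π₁ ⟨$⟩ʳ x′) y′
  where
  π₁ = transpose x y
  π₂ = transpose (π₁ ⟨$⟩ʳ x′) y′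
  fixes : π₂ ⟨$⟩ʳ (π₁ ⟨$⟩ʳ x) ≡ y
  fixes rewrite transpose-left x y =
    transpose-fix _ y′ y (λ eq → x≢x′ (perm-injective π₁ (trans (transpose-left x y) eq))) y≢y′

-- The root is `base` in every coordinate, `flat` fills coordinate `j` on the hyperplane of `F`, the
-- tones are the entries of `F` in the other coordinates, and `priv ℓ` belongs to leg `ℓ` alone.
data Colour (L κ : ℕ) : Set where
  base flat : Colour L κ
  priv      : Fin L → Colour L κ
  tone      : Fin κ → Colour L κ

encode : ∀ {L κ} → Colour L κ → Fin (2 + (L + κ))
encode         base     = zero
encode         flat     = suc zero
encode {L} {κ} (priv ℓ) = suc (suc (join L κ (inj₁ ℓ)))
encode {L} {κ} (tone t) = suc (suc (join L κ (inj₂ t)))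

join-injective : ∀ m n {x y} → join m n x ≡ join m n y → x ≡ y
join-injective m n {x} {y} eq =
  trans (sym (Fin.splitAt-join m n x)) (trans (cong (splitAt m) eq) (Fin.splitAt-join m n y))

encode-injective : ∀ {L κ} {c c′ : Colour L κ} → encode c ≡ encode c′ → c ≡ c′
encode-injective         {c = base}   {base}    _  = refl
encode-injective         {c = flat}   {flat}    _  = refl
encode-injective {L} {κ} {c = priv _} {priv _} eq
  with refl ← join-injective L κ {inj₁ _} {inj₁ _} (Fin.suc-injective (Fin.suc-injective eq)) = refl
encode-injective {L} {κ} {c = priv _} {tone _} eq
  with () ← join-injective L κ {inj₁ _} {inj₂ _} (Fin.suc-injective (Fin.suc-injective eq))
encode-injective {L} {κ} {c = tone _} {priv _} eq
  with () ← join-injective L κ {inj₂ _} {inj₁ _} (Fin.suc-injective (Fin.suc-injective eq))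
encode-injective {L} {κ} {c = tone _} {tone _} eq
  with refl ← join-injective L κ {inj₂ _} {inj₂ _} (Fin.suc-injective (Fin.suc-injective eq)) = refl

-- Two colours can be steered in each coordinate. This is enough to bring two vertices of the
-- configuration to the given ends `u` and `v`.
paint : ∀ {L κ} {c c′ : Colour L κ} {z z′ : Fin (2 + (L + κ))} → c ≢ c′ → z ≢ z′ →
        ∃ λ (σ : Colour L κ → Fin (2 + (L + κ))) →
          (∀ {a b} → σ a ≡ σ b → a ≡ b) × σ c ≡ z × σ c′ ≡ z′
paint c≢c′ z≢z′ with π , πc , πc′ ← prescribe (c≢c′ ∘ encode-injective) z≢z′ =
  (λ a → π ⟨$⟩ʳ encode a) , (λ eq → encode-injective (perm-injective π eq)) , πc , πc′

paint-base : ∀ {L κ} (z : Fin (2 + (L + κ))) →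
             ∃ λ (σ : Colour L κ → Fin (2 + (L + κ))) →
               (∀ {a b} → σ a ≡ σ b → a ≡ b) × σ base ≡ z
paint-base z = (λ a → π ⟨$⟩ʳ encode a) , (λ eq → encode-injective (perm-injective π eq)) , transpose-left zero z
  where π = transpose zero z

-- The colours available to leg ℓ before it enters the tones of F.
data Early {L κ : ℕ} (ℓ : Fin L) : Colour L κ → Set where
  base : Early ℓ base
  flat : Early ℓ flat
  priv : Early ℓ (priv ℓ)

Tone : ∀ {L κ} → Colour L κ → Set
Tone c = ∃ λ t → c ≡ tone t

tone≢early : ∀ {L κ} {ℓ : Fin L} {c c′ : Colour L κ} → Tone c → Early ℓ c′ → c ≢ c′
tone≢early (_ , refl) () refl

tone≢priv : ∀ {L κ} {ℓ : Fin L} {c : Colour L κ} → Tone c → c ≢ priv ℓ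
tone≢priv t = tone≢early t priv

early≢priv : ∀ {L κ} {ℓ ℓ′ : Fin L} {c : Colour L κ} → ℓ ≢ ℓ′ → Early ℓ c → c ≢ priv ℓ′
early≢priv ℓ≢ℓ priv refl = ℓ≢ℓ refl

-- Codes for the vertices and edges of H

-- Vertices of H, with the vertices of leg ℓ listed from the root as
-- root, first ℓ, mid ℓ 0, …, mid ℓ (n ∸ 1), body (leaf ℓ).
data Code (n L : ℕ) (F : Graph) : Set where
  root  : Code n L F
  first : Fin L → Code n L F
  mid   : Fin L → Fin n → Code n L F
  body  : V F → Code n L F

module Codes {m L : ℕ} {F : Graph} (leaf : Fin L → V F) where

  -- Leg edges are directed away from the root; `CodeAdj` symmetrises them. The last inner vertex of
  -- a leg has index `m`, and only from there does a step lead into `F`.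
  step : Code (suc m) L F → Code (suc m) L F → Set
  step root      (first _)  = ⊤
  step (first ℓ) (mid ℓ′ s) = ℓ ≡ ℓ′ × toℕ s ≡ 0
  step (mid ℓ s) (mid ℓ′ t) = ℓ ≡ ℓ′ × suc (toℕ s) ≡ toℕ t
  step (mid ℓ s) (body y)   = leaf ℓ ≡ y × toℕ s ≡ m
  step (body y)  (body z)   = Adj F y z
  step _         _          = ⊥

  CodeAdj : Code (suc m) L F → Code (suc m) L F → Set
  CodeAdj c d = step c d ⊎ step d c

  -- The top index is the leaf. It is coded as a vertex of `F`, so that a vertex shared by `F` and
  -- `T` has a single code.
  past-first : Fin L → {b : Fin (suc (suc m))} → View b → Code (suc m) L F
  past-first ℓ ‵fromℕ      = body (leaf ℓ)
  past-first ℓ (‵inject₁ s) = mid ℓ s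

  code-at : Fin L → Fin (3 + suc m) → Code (suc m) L F
  code-at ℓ zero          = root
  code-at ℓ (suc zero)    = first ℓ
  code-at ℓ (suc (suc b)) = past-first ℓ (view b)

  step-along : ∀ ℓ a → step (code-at ℓ (inject₁ a)) (code-at ℓ (suc a))
  step-along ℓ zero          = tt
  step-along ℓ (suc zero)    = refl , refl
  step-along ℓ (suc (suc b)) rewrite view-inject₁ b with view b
  ... | ‵fromℕ     = refl , Fin.toℕ-fromℕ m
  ... | ‵inject₁ s = refl , cong suc (Fin.toℕ-inject₁ s)

-- Legs and leaves of a balanced spider

module Spider {p q : ℕ} {T : Graph} (spider : IsBalancedSpider (2 + p) (2 + q) T) where
  open IsBalancedSpider spider public

  top : Fin (3 + q)
  top = fromℕ (2 + q)

  -- Different legs meet only in the root, and by injectivity a leg visits the root only at index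
  -- `zero`.
  leg-unique : ∀ {i j a b} → leg i a ≡ leg j b → (a ≡ zero × b ≡ zero) ⊎ (i ≡ j × a ≡ b)
  leg-unique {i} {j} {a} {b} eq with i ≟ j
  ... | yes refl = inj₂ (refl , leg-path i eq)
  ... | no i≢j   = inj₁
    ( leg-path i (trans at-root (sym (leg-start i)))
    , leg-path j (trans (trans (sym eq) at-root) (sym (leg-start j))))
    where at-root = disjoint i j i≢j a b eq

  leg-edge : ∀ i a → Adj T (leg i (inject₁ a)) (leg i (suc a))
  leg-edge i a = from (edges _ _) (i , a , inj₁ (refl , refl))

  leg-edge′ : ∀ i {a b} → suc (toℕ a) ≡ toℕ b → Adj T (leg i a) (leg i b)
  leg-edge′ i {a} {suc b} eq =
    subst (λ c → Adj T (leg i c) (leg i (suc b)))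
          (Fin.toℕ-injective (trans (Fin.toℕ-inject₁ b) (sym (ℕ.suc-injective eq)))) (leg-edge i b)

  top-leaf : ∀ i → IsLeaf T (leg i top)
  top-leaf i = leg i (inject₁ last) , symm T (leg-edge i last) , unique
    where
    last : Fin (2 + q)
    last = fromℕ (suc q)
    unique : ∀ {y} → Adj T (leg i top) y → leg i (inject₁ last) ≡ y
    unique adj with to (edges _ _) adj
    ... | j , a , inj₁ (eq , _) with leg-unique eq
    ...   | inj₂ (refl , top≡) = contradiction top≡ Fin.fromℕ≢inject₁
    unique adj | j , a , inj₂ (eq , refl) with leg-unique eq
    ...   | inj₂ (refl , top≡) = cong (leg i ∘ inject₁) (Fin.suc-injective top≡)

  -- The root has neighbours on two different legs, and an inner vertex has the vertices before and
  -- after it as neighbours, so neither has degree 1.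
  leaf-top : ∀ i a → IsLeaf T (leg i a) → a ≡ top
  leaf-top i zero (y , _ , unique)
    with leg-unique (trans (sym (unique (nbr zero))) (unique (nbr (suc zero))))
    where
    nbr : ∀ j → Adj T (leg i zero) (leg j (suc zero))
    nbr j = subst (λ r → Adj T r (leg j (suc zero)))
                  (trans (leg-start j) (sym (leg-start i))) (leg-edge j zero)
  ... | inj₁ ()
  ... | inj₂ (() , _)
  leaf-top i (suc b) (y , _ , unique) with view b
  ... | ‵fromℕ = refl
  ... | ‵inject₁ c
    with leg-unique {a = suc (suc c)} {b = inject₁ (inject₁ c)}
           (trans (sym (unique (leg-edge i (suc c)))) (unique (symm T (leg-edge i (inject₁ c)))))
  ... | inj₂ (_ , c+2≡c) = contradiction
          (trans (cong toℕ c+2≡c) (trans (Fin.toℕ-inject₁ (inject₁ c)) (Fin.toℕ-inject₁ c)))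
          (ℕ.>⇒≢ (ℕ.m≤n+m _ 1))

-- Passage between codes and vertices of H

module Decoding {m p : ℕ} {H F T : Graph}
  (spider : IsBalancedSpider (2 + p) (2 + suc m) T) (union : IsUnion F T (IsLeaf T) H) where
  open Spider spider hiding (root)
  open IsUnion union using (ιF; ιT; ιF-injective; ιT-injective; intersection)

  leaf-in-F : ∀ ℓ → ∃ λ f → ιF f ≡ ιT (leg ℓ top)
  leaf-in-F ℓ = from (intersection (leg ℓ top)) (top-leaf ℓ)

  leaf : Fin (2 + p) → V F
  leaf = proj₁ ∘ leaf-in-F

  leaf-injective : ∀ {ℓ ℓ′} → leaf ℓ ≡ leaf ℓ′ → ℓ ≡ ℓ′
  leaf-injective {ℓ} {ℓ′} eq
    with leg-unique {b = top} (ιT-injective (trans (sym (proj₂ (leaf-in-F ℓ)))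
           (trans (cong ιF eq) (proj₂ (leaf-in-F ℓ′)))))
  ... | inj₂ (ℓ≡ℓ′ , _) = ℓ≡ℓ′

  open Codes {m} {2 + p} {F} leaf public

  decode : Code (suc m) (2 + p) F → V H
  -- Any leg would do, since all of them start at the root.
  decode root      = ιT (leg zero zero)
  decode (first ℓ) = ιT (leg ℓ (suc zero))
  decode (mid ℓ s) = ιT (leg ℓ (suc (suc (inject₁ s))))
  decode (body y)  = ιF y

  inner≢body : ∀ ℓ a y → a ≢ top → ιT (leg ℓ a) ≢ ιF y
  inner≢body ℓ a y a≢top eq = a≢top (leaf-top ℓ a (to (intersection _) (y , sym eq)))

  zero≢top : zero ≢ top
  zero≢top ()

  one≢top : suc zero ≢ top
  one≢top ()

  mid≢top : ∀ s → suc (suc (inject₁ s)) ≢ top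
  mid≢top s eq = Fin.fromℕ≢inject₁ (sym (Fin.suc-injective (Fin.suc-injective eq)))

  decode-injective : ∀ c d → decode c ≡ decode d → c ≡ d
  decode-injective root root eq = refl
  decode-injective root (first ℓ) eq with leg-unique (ιT-injective eq)
  ... | inj₁ (_ , ())
  ... | inj₂ (_ , ())
  decode-injective root (mid ℓ s) eq with leg-unique (ιT-injective eq)
  ... | inj₁ (_ , ())
  ... | inj₂ (_ , ())
  decode-injective root (body y) eq = ⊥-elim (inner≢body _ _ y zero≢top eq)
  decode-injective (first ℓ) root eq = sym (decode-injective root (first ℓ) (sym eq))
  decode-injective (first ℓ) (first ℓ′) eq with leg-unique (ιT-injective eq)
  ... | inj₂ (refl , _) = refl
  decode-injective (first ℓ) (mid ℓ′ s) eq with leg-unique (ιT-injective eq)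
  ... | inj₁ (() , _)
  ... | inj₂ (_ , ())
  decode-injective (first ℓ) (body y) eq = ⊥-elim (inner≢body _ _ y one≢top eq)
  decode-injective (mid ℓ s) root eq = sym (decode-injective root (mid ℓ s) (sym eq))
  decode-injective (mid ℓ s) (first ℓ′) eq = sym (decode-injective (first ℓ′) (mid ℓ s) (sym eq))
  decode-injective (mid ℓ s) (mid ℓ′ t) eq with leg-unique (ιT-injective eq)
  ... | inj₂ (refl , s≡t) =
    cong (mid ℓ) (Fin.inject₁-injective (Fin.suc-injective (Fin.suc-injective s≡t)))
  decode-injective (mid ℓ s) (body y) eq = ⊥-elim (inner≢body _ _ y (mid≢top s) eq)
  decode-injective (body y) (body z) eq = cong body (ιF-injective eq)
  decode-injective (body y) root eq = ⊥-elim (inner≢body _ _ y zero≢top (sym eq))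
  decode-injective (body y) (first ℓ) eq = ⊥-elim (inner≢body _ _ y one≢top (sym eq))
  decode-injective (body y) (mid ℓ s) eq = ⊥-elim (inner≢body _ _ y (mid≢top s) (sym eq))

  decode-leg : ∀ ℓ a → decode (code-at ℓ a) ≡ ιT (leg ℓ a)
  decode-leg ℓ zero       = cong ιT (trans (leg-start zero) (sym (leg-start ℓ)))
  decode-leg ℓ (suc zero) = refl
  decode-leg ℓ (suc (suc b)) with view b
  ... | ‵fromℕ     = proj₂ (leaf-in-F ℓ)
  ... | ‵inject₁ s = refl

  code : ∀ x → ∃ λ c → decode c ≡ x
  code x with IsUnion.vertices union x
  ... | inj₁ (f , refl) = body f , refl
  ... | inj₂ (t , refl) with vertices t
  ...   | ℓ , a , refl = code-at ℓ a , decode-leg ℓ a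

  codeAdj-sound : ∀ c d → Adj H (decode c) (decode d) → CodeAdj c d
  codeAdj-sound c d adj with to (IsUnion.edges union _ _) adj
  ... | inj₁ (f , g , fg , c≡ , d≡)
    with refl ← decode-injective c (body f) c≡ | refl ← decode-injective d (body g) d≡ = inj₁ fg
  ... | inj₂ (s , t , st , c≡ , d≡) with to (edges s t) st
  ...   | ℓ , a , inj₁ (refl , refl)
    with refl ← decode-injective c (code-at ℓ (inject₁ a)) (trans c≡ (sym (decode-leg ℓ _)))
       | refl ← decode-injective d (code-at ℓ (suc a)) (trans d≡ (sym (decode-leg ℓ _)))
    = inj₁ (step-along ℓ a)
  ...   | ℓ , a , inj₂ (refl , refl)
    with refl ← decode-injective c (code-at ℓ (suc a)) (trans c≡ (sym (decode-leg ℓ _)))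
       | refl ← decode-injective d (code-at ℓ (inject₁ a)) (trans d≡ (sym (decode-leg ℓ _)))
    = inj₂ (step-along ℓ a)

  T-edge : ∀ {s t} → Adj T s t → Adj H (ιT s) (ιT t)
  T-edge st = from (IsUnion.edges union _ _) (inj₂ (_ , _ , st , refl , refl))

  step-edge : ∀ c d → step c d → Adj H (decode c) (decode d)
  step-edge root (first ℓ) _ =
    subst (λ r → Adj H r (ιT (leg ℓ (suc zero)))) (sym (decode-leg ℓ zero)) (T-edge (leg-edge ℓ zero))
  step-edge (first ℓ) (mid .ℓ s) (refl , s≡0) =
    T-edge (leg-edge′ ℓ (cong (2 +_) (sym (trans (Fin.toℕ-inject₁ s) s≡0))))
  step-edge (mid ℓ s) (mid .ℓ t) (refl , s+1≡t) =
    T-edge (leg-edge′ ℓ (cong (2 +_)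
      (trans (cong suc (Fin.toℕ-inject₁ s)) (trans s+1≡t (sym (Fin.toℕ-inject₁ t))))))
  step-edge (mid ℓ s) (body .(leaf ℓ)) (refl , s≡m) =
    subst (Adj H _) (sym (proj₂ (leaf-in-F ℓ)))
      (T-edge (leg-edge′ ℓ (cong (3 +_)
        (trans (Fin.toℕ-inject₁ s) (trans s≡m (sym (Fin.toℕ-fromℕ m)))))))
  step-edge (body y) (body z) yz = from (IsUnion.edges union _ _) (inj₁ (y , z , yz , refl , refl))

  codeAdj-complete : ∀ c d → CodeAdj c d → Adj H (decode c) (decode d)
  codeAdj-complete c d (inj₁ cd) = step-edge c d cd
  codeAdj-complete c d (inj₂ dc) = symm H (step-edge d c dc)

  -- Reduces an induced copy of `H` to a check on pairs of codes, so that the constructions for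
  -- deletion and addition never look at `H` itself.
  induced-by-codes : ∀ {G} (e : Code (suc m) (2 + p) F → V G) →
    (∀ c d → c ≡ d ⊎ (e c ≢ e d × (CodeAdj c d ⇔ Adj G (e c) (e d)))) → H ⊆ᴵ G
  induced-by-codes {G} e faithful = record
    { embed     = e ∘ encoding
    ; injective = λ {x} {y} eq → inj x y (faithful (encoding x) (encoding y)) eq
    ; induced   = λ x y → mk⇔ (there x y (faithful (encoding x) (encoding y)))
                              (back x y (faithful (encoding x) (encoding y)))
    }
    where
    encoding : V H → Code (suc m) (2 + p) F
    encoding = proj₁ ∘ code

    recover : ∀ {x y} → encoding x ≡ encoding y → x ≡ y
    recover {x} {y} eq = trans (sym (proj₂ (code x))) (trans (cong decode eq) (proj₂ (code y)))

    coded : ∀ {x y} → Adj H x y → CodeAdj (encoding x) (encoding y)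
    coded {x} {y} = codeAdj-sound (encoding x) (encoding y) ∘ subst₂ (Adj H) (sym (proj₂ (code x))) (sym (proj₂ (code y)))

    Faithful : V H → V H → Set
    Faithful x y = encoding x ≡ encoding y ⊎
      (e (encoding x) ≢ e (encoding y) ×
       (CodeAdj (encoding x) (encoding y) ⇔ Adj G (e (encoding x)) (e (encoding y))))

    inj : ∀ x y → Faithful x y → e (encoding x) ≡ e (encoding y) → x ≡ y
    inj x y (inj₁ eq)        _    = recover eq
    inj x y (inj₂ (≢ , _)) ≡-img = contradiction ≡-img ≢

    there : ∀ x y → Faithful x y → Adj H x y → Adj G (e (encoding x)) (e (encoding y))
    there x y (inj₁ eq)        xy = ⊥-elim (irrefl H (recover eq) xy)
    there x y (inj₂ (_ , iff)) xy = to iff (coded xy)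

    back : ∀ x y → Faithful x y → Adj G (e (encoding x)) (e (encoding y)) → Adj H x y
    back x y (inj₁ eq)        adj = ⊥-elim (irrefl G (cong e eq) adj)
    back x y (inj₂ (_ , iff)) adj =
      subst₂ (Adj H) (proj₂ (code x)) (proj₂ (code y)) (codeAdj-complete (encoding x) (encoding y) (from iff adj))

  avoids-hamming : ∀ {n k} → n < 2 + p → ¬ (H ⊆ᴵ □^ n K k)
  avoids-hamming {n} {k} n<2+p emb = clash
    where
    open _⊆ᴵ_ emb
    r : Vec (Fin k) n
    r = embed (decode root)
    w : Fin (2 + p) → Vec (Fin k) n
    w ℓ = embed (decode (first ℓ))
    edge : ∀ ℓ → DifferInOne r (w ℓ)
    edge ℓ = to (induced _ _) (codeAdj-complete root (first ℓ) (inj₁ tt))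
    direction : Fin (2 + p) → Fin n
    direction = proj₁ ∘ edge
    elsewhere : ∀ ℓ x → x ≢ direction ℓ → lookup r x ≡ lookup (w ℓ) x
    elsewhere ℓ x x≢ = decidable-stable (lookup r x ≟ lookup (w ℓ) x)
      λ differ → x≢ (sym (proj₂ (proj₂ (edge ℓ)) differ))
    clash : ⊥
    -- Two first vertices that leave the root in the same direction agree in all other coordinates.
    -- If they agree in this one too, they coincide; if not, they are adjacent. Distinct legs allow
    -- neither.
    clash with Fin.pigeonhole n<2+p direction
    ... | ℓ , ℓ′ , ℓ<ℓ′ , same with lookup (w ℓ) (direction ℓ) ≟ lookup (w ℓ′) (direction ℓ)
    ...   | yes agree = contradiction
              (decode-injective (first ℓ) (first ℓ′) (injective (lookup-ext equal))) ℓ≢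
      where
      ℓ≢ : first ℓ ≢ first ℓ′
      ℓ≢ refl = ℕ.<-irrefl refl ℓ<ℓ′
      equal : ∀ x → lookup (w ℓ) x ≡ lookup (w ℓ′) x
      equal x with x ≟ direction ℓ
      ... | yes refl = agree
      ... | no x≢    = trans (sym (elsewhere ℓ x x≢)) (elsewhere ℓ′ x (x≢ ∘ λ eq → trans eq (sym same)))
    ...   | no differ = [ (λ ()) , (λ ()) ]′ (codeAdj-sound (first ℓ) (first ℓ′)
              (from (induced _ _) (diffOne-at _ differ λ x x≢ →
                trans (sym (elsewhere ℓ x x≢)) (elsewhere ℓ′ x (x≢ ∘ λ eq → trans eq (sym same))))))

-- Layout of H by colour tuples

-- second is the vertex after start.  From there on the coordinates are
-- replaced by those of the leaf, pivot last but one and j last.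
record Leg {n L : ℕ} (κ : ℕ) (j : Fin n) (ℓ : Fin L) : Set where
  field
    pivot        : Fin n
    pivot≢j      : pivot ≢ j
    start second : Fin n → Colour L κ
    start-early  : ∀ x → Early ℓ (start x)
    -- All of `F` is `flat` at `j`, so this keeps the first vertex off the hyperplane.
    start-j      : start j ≢ flat
    second-early : ∀ x → Early ℓ (second x)
    second-j     : second j ≡ priv ℓ
    second-pivot : second pivot ≡ priv ℓ
    -- The only coordinate that changes from `start` to `second`. Being `j` or the pivot, on the
    -- `mid` vertices it never returns to its value in `start`, so it also separates the first
    -- vertex from the later ones.
    turn         : Fin n
    turn∈        : turn ≡ j ⊎ turn ≡ pivot
    turn-changes : start turn ≢ priv ℓ
    turn-only    : ∀ x → x ≢ turn → start x ≡ second x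

module Layout {n₀ L κ : ℕ} {F : Graph} (leaf : Fin L → V F)
  (leaf-injective : ∀ {ℓ ℓ′ : Fin L} → leaf ℓ ≡ leaf ℓ′ → ℓ ≡ ℓ′)
  (place : F ⊆ᴵ □^ (2 + n₀) K κ) (j : Fin (3 + n₀)) (legs : (ℓ : Fin L) → Leg κ j ℓ) where
  open Codes {2 + n₀} {L} {F} leaf
  open module AtLeg (ℓ : Fin L) = Leg (legs ℓ)
  open _⊆ᴵ_ place

  hyperplane : V F → Fin (3 + n₀) → Colour L κ
  hyperplane y = lookup (insertAt (map tone (embed y)) j flat)

  hyperplane-j : ∀ y → hyperplane y j ≡ flat
  hyperplane-j y = insertAt-lookup _ j flat

  hyperplane-punchIn : ∀ y x → hyperplane y (punchIn j x) ≡ tone (lookup (embed y) x)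
  hyperplane-punchIn y x = trans (insertAt-punchIn _ j flat x) (lookup-map x tone (embed y))

  hyperplane-tone : ∀ y x → x ≢ j → Tone (hyperplane y x)
  hyperplane-tone y x x≢j =
    subst (Tone ∘ hyperplane y) (Fin.punchIn-punchOut (≢-sym x≢j)) (_ , hyperplane-punchIn y _)

  tone-injective : ∀ {s t} → tone {L} {κ} s ≡ tone t → s ≡ t
  tone-injective refl = refl

  hyperplane-differ : ∀ y z x → lookup (embed y) x ≢ lookup (embed z) x →
                      hyperplane y (punchIn j x) ≢ hyperplane z (punchIn j x)
  hyperplane-differ y z x differ eq = differ (tone-injective
    (trans (sym (hyperplane-punchIn y x)) (trans eq (hyperplane-punchIn z x))))

  hyperplane-differ⁻ : ∀ y z x → hyperplane y x ≢ hyperplane z x →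
                       ∃ λ x′ → punchIn j x′ ≡ x × lookup (embed y) x′ ≢ lookup (embed z) x′
  hyperplane-differ⁻ y z x differ with j ≟ x
  ... | yes refl = contradiction (trans (hyperplane-j y) (sym (hyperplane-j z))) differ
  ... | no j≢x = punchOut j≢x , Fin.punchIn-punchOut j≢x , λ eq → differ
    (subst (λ x → hyperplane y x ≡ hyperplane z x) (Fin.punchIn-punchOut j≢x)
      (trans (hyperplane-punchIn y _) (trans (cong tone eq) (sym (hyperplane-punchIn z _)))))

  -- The coordinate found is not `j`. Together with a difference in `j` it yields the two
  -- differences that exclude adjacency.
  hyperplane-injective : ∀ {y z} → y ≢ z → ∃ λ x → x ≢ j × hyperplane y x ≢ hyperplane z x
  hyperplane-injective {y} {z} y≢z with any? (λ x → ¬? (lookup (embed y) x ≟ lookup (embed z) x))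
  ... | yes (x , differ) = punchIn j x , Fin.punchInᵢ≢i j x , hyperplane-differ y z x differ
  ... | no agree = contradiction
    (injective (lookup-ext λ x → decidable-stable (_ ≟ _) λ d → agree (x , d))) y≢z

  hyperplane-adj : ∀ y z → Adj F y z ⇔ DiffOne (hyperplane y) (hyperplane z)
  hyperplane-adj y z = mk⇔ (there ∘ to (induced y z)) (from (induced y z) ∘ back)
    where
    there : DifferInOne (embed y) (embed z) → DiffOne (hyperplane y) (hyperplane z)
    there (x , differ , unique) = punchIn j x , hyperplane-differ y z x differ , only
      where
      only : ∀ {x′} → hyperplane y x′ ≢ hyperplane z x′ → punchIn j x ≡ x′
      only d with hyperplane-differ⁻ y z _ d
      ... | _ , refl , d′ = cong (punchIn j) (unique d′)
    back : DiffOne (hyperplane y) (hyperplane z) → DifferInOne (embed y) (embed z)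
    back (x , differ , unique) with hyperplane-differ⁻ y z x differ
    ... | x′ , refl , d = x′ , d , λ d′ → Fin.punchIn-injective j _ _ (unique (hyperplane-differ y z _ d′))

  last : Fin (3 + n₀)
  last = fromℕ (2 + n₀)

  last-but-one : Fin (3 + n₀)
  last-but-one = inject₁ (fromℕ (1 + n₀))

  abstract
    -- The order in which leg `ℓ` replaces its coordinates, as a permutation: `time` applies it and
    -- `changed-at` inverts it. Only the last two places are prescribed.
    schedule : ∀ ℓ → ∃ λ (π : Permutation′ (3 + n₀)) → π ⟨$⟩ʳ pivot ℓ ≡ last-but-one × π ⟨$⟩ʳ j ≡ last
    schedule ℓ = prescribe (pivot≢j ℓ) (≢-sym Fin.fromℕ≢inject₁)

  time : Fin L → Fin (3 + n₀) → ℕ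
  time ℓ x = toℕ (proj₁ (schedule ℓ) ⟨$⟩ʳ x)

  time-j : ∀ ℓ → time ℓ j ≡ 2 + n₀
  time-j ℓ = trans (cong toℕ (proj₂ (proj₂ (schedule ℓ)))) (Fin.toℕ-fromℕ _)

  time-pivot : ∀ ℓ → time ℓ (pivot ℓ) ≡ 1 + n₀
  time-pivot ℓ = trans (cong toℕ (proj₁ (proj₂ (schedule ℓ))))
                       (trans (Fin.toℕ-inject₁ (fromℕ (1 + n₀))) (Fin.toℕ-fromℕ _))

  time-injective : ∀ ℓ {x y} → time ℓ x ≡ time ℓ y → x ≡ y
  time-injective ℓ = perm-injective (proj₁ (schedule ℓ)) ∘ Fin.toℕ-injective

  changed-at : Fin L → Fin (3 + n₀) → Fin (3 + n₀)
  changed-at ℓ s = proj₁ (schedule ℓ) ⟨$⟩ˡ s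

  time-changed-at : ∀ ℓ s → time ℓ (changed-at ℓ s) ≡ toℕ s
  time-changed-at ℓ s = cong toℕ (Perm.inverseʳ (proj₁ (schedule ℓ)))

  time<⇒≢j : ∀ ℓ x → time ℓ x < 2 + n₀ → x ≢ j
  time<⇒≢j ℓ x early refl = ℕ.<⇒≢ early (time-j ℓ)

  -- The tuple of `mid ℓ s`. The index stops at `2 + n₀`, where only `j` is left to be replaced;
  -- replacing it is the edge to the leaf.
  tail : Fin L → ℕ → Fin (3 + n₀) → Colour L κ
  tail ℓ s x with time ℓ x <? s
  ... | yes _ = hyperplane (leaf ℓ) x
  ... | no _  = second ℓ x

  tail-after : ∀ ℓ {s} x → time ℓ x < s → tail ℓ s x ≡ hyperplane (leaf ℓ) x
  tail-after ℓ {s} x lt with time ℓ x <? s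
  ... | yes _ = refl
  ... | no ≮  = contradiction lt ≮

  tail-before : ∀ ℓ {s} x → s ≤ time ℓ x → tail ℓ s x ≡ second ℓ x
  tail-before ℓ {s} x le with time ℓ x <? s
  ... | yes lt = contradiction lt (ℕ.≤⇒≯ le)
  ... | no _   = refl

  tail-j : ∀ ℓ (s : Fin (3 + n₀)) → tail ℓ (toℕ s) j ≡ priv ℓ
  tail-j ℓ s = trans (tail-before ℓ j (subst (toℕ s ≤_) (sym (time-j ℓ)) (Fin.toℕ≤pred[n] s))) (second-j ℓ)

  tail-pivot-before : ∀ ℓ {s} → s ≤ 1 + n₀ → tail ℓ s (pivot ℓ) ≡ priv ℓ
  tail-pivot-before ℓ {s} le =
    trans (tail-before ℓ _ (subst (s ≤_) (sym (time-pivot ℓ)) le)) (second-pivot ℓ)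

  tail-pivot : ∀ ℓ s → tail ℓ s (pivot ℓ) ≡ priv ℓ ⊎ Tone (tail ℓ s (pivot ℓ))
  tail-pivot ℓ s with time ℓ (pivot ℓ) <? s
  ... | yes _ = inj₂ (hyperplane-tone (leaf ℓ) _ (pivot≢j ℓ))
  ... | no _  = inj₁ (second-pivot ℓ)

  tail-others : ∀ ℓ s x → x ≢ j → Early ℓ (tail ℓ s x) ⊎ Tone (tail ℓ s x)
  tail-others ℓ s x x≢j with time ℓ x <? s
  ... | yes _ = inj₂ (hyperplane-tone (leaf ℓ) x x≢j)
  ... | no _  = inj₁ (second-early ℓ x)

  tail-last : ∀ ℓ {s} → s ≡ 2 + n₀ → ∀ x → x ≢ j → tail ℓ s x ≡ hyperplane (leaf ℓ) x
  tail-last ℓ {s} refl x x≢j = tail-after ℓ x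
    (ℕ.≤∧≢⇒< (Fin.toℕ≤pred[n] (proj₁ (schedule ℓ) ⟨$⟩ʳ x))
      λ eq → x≢j (time-injective ℓ (trans eq (sym (time-j ℓ)))))

  position : Code (3 + n₀) L F → Fin (3 + n₀) → Colour L κ
  position root      = λ _ → base
  position (first ℓ) = start ℓ
  position (mid ℓ s) = tail ℓ (toℕ s)
  position (body y)  = hyperplane y

  -- Non-adjacent codes could still share a tuple, so `apart` is kept beside `iff`. Both concern
  -- colours only and hence survive every painting.
  record Separated (c d : Code (3 + n₀) L F) : Set where
    constructor separated
    field
      apart : Apart (position c) (position d)
      iff   : CodeAdj c d ⇔ DiffOne (position c) (position d)

  open Separated public

  Separated-sym : ∀ {c d} → Separated c d → Separated d c
  Separated-sym (separated (x , differ) adj) =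
    separated (x , ≢-sym differ) (mk⇔ (diffOne-sym ∘ to adj ∘ swap) (swap ∘ from adj ∘ diffOne-sym))

  far : ∀ {c d} x y → x ≢ y → position c x ≢ position d x → position c y ≢ position d y →
        ¬ CodeAdj c d → Separated c d
  far x y x≢y dx dy ¬adj =
    separated (x , dx) (mk⇔ (⊥-elim ∘ ¬adj) (⊥-elim ∘ ¬diffOne x y x≢y dx dy))

  near : ∀ {c d} x → position c x ≢ position d x →
         (∀ y → y ≢ x → position c y ≡ position d y) → CodeAdj c d → Separated c d
  near x dx same adj = separated (x , dx) (mk⇔ (λ _ → diffOne-at x dx same) (λ _ → adj))

  -- Replacing a coordinate other than `j` turns an early colour into a tone, hence always changes
  -- it. The last bound on the time rules out `j`.
  mid-differ : ∀ ℓ {s t} x → s ≤ time ℓ x → time ℓ x < t → time ℓ x < 2 + n₀ → tail ℓ s x ≢ tail ℓ t x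
  mid-differ ℓ x s≤ <t <m eq = tone≢early (hyperplane-tone (leaf ℓ) x (time<⇒≢j ℓ x <m)) (second-early ℓ x)
    (trans (sym (tail-after ℓ x <t)) (trans (sym eq) (tail-before ℓ x s≤)))

  mid-mid-same : ∀ ℓ s t → toℕ s < toℕ t → Separated (mid ℓ s) (mid ℓ t)
  mid-mid-same ℓ s t s<t with suc (toℕ s) ℕ.≟ toℕ t
  ... | yes s+1≡t = near (changed-at ℓ s) differ same (inj₁ (refl , s+1≡t))
    where
    at-s = time-changed-at ℓ s
    differ = mid-differ ℓ (changed-at ℓ s) (ℕ.≤-reflexive (sym at-s)) (subst (_< toℕ t) (sym at-s) s<t)
      (subst (_< 2 + n₀) (sym at-s) (ℕ.<-≤-trans s<t (Fin.toℕ≤pred[n] t)))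
    same : ∀ y → y ≢ changed-at ℓ s → tail ℓ (toℕ s) y ≡ tail ℓ (toℕ t) y
    same y y≢ with ℕ.<-cmp (time ℓ y) (toℕ s)
    ... | tri< lt _ _ = trans (tail-after ℓ y lt) (sym (tail-after ℓ y (ℕ.<-trans lt s<t)))
    ... | tri≈ _ eq _ = contradiction (time-injective ℓ (trans eq (sym at-s))) y≢
    ... | tri> _ _ gt = trans (tail-before ℓ y (ℕ.<⇒≤ gt))
                              (sym (tail-before ℓ y (subst (_≤ time ℓ y) s+1≡t gt)))
  -- At least two coordinates have been replaced between the vertices, namely those of times `s` and
  -- `s + 1`, and both differ.
  ... | no s+1≢t = far (changed-at ℓ s) (changed-at ℓ s⁺) distinct
      (differ s ℕ.≤-refl s<t) (differ s⁺ (ℕ.≤-trans (ℕ.n≤1+n _) (ℕ.≤-reflexive (sym toℕ-s⁺))) s⁺<t)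
      [ (λ (_ , eq) → s+1≢t eq) , (λ (_ , eq) → ℕ.<-asym s<t (ℕ.≤-reflexive eq)) ]′
    where
    s+1<t = ℕ.≤∧≢⇒< s<t s+1≢t
    s+1<n = ℕ.<-trans s+1<t (Fin.toℕ<n t)
    s⁺ : Fin (3 + n₀)
    s⁺ = fromℕ< s+1<n
    toℕ-s⁺ : toℕ s⁺ ≡ suc (toℕ s)
    toℕ-s⁺ = Fin.toℕ-fromℕ< s+1<n
    s⁺<t : toℕ s⁺ < toℕ t
    s⁺<t = subst (_< toℕ t) (sym toℕ-s⁺) s+1<t
    differ : ∀ r → toℕ s ≤ toℕ r → toℕ r < toℕ t → tail ℓ (toℕ s) (changed-at ℓ r) ≢ tail ℓ (toℕ t) (changed-at ℓ r)
    differ r s≤r r<t = mid-differ ℓ (changed-at ℓ r) (subst (toℕ s ≤_) (sym at-r) s≤r)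
      (subst (_< toℕ t) (sym at-r) r<t)
      (subst (_< 2 + n₀) (sym at-r) (ℕ.<-≤-trans r<t (Fin.toℕ≤pred[n] t)))
      where at-r = time-changed-at ℓ r
    distinct : changed-at ℓ s ≢ changed-at ℓ s⁺
    distinct eq = ℕ.<⇒≢ ℕ.≤-refl (trans (sym (time-changed-at ℓ s))
      (trans (cong (time ℓ) eq) (trans (time-changed-at ℓ s⁺) toℕ-s⁺)))

  before-or-at-end : (s : Fin (3 + n₀)) → toℕ s ≤ 1 + n₀ ⊎ toℕ s ≡ 2 + n₀
  before-or-at-end s with toℕ s ℕ.≟ 2 + n₀
  ... | yes eq = inj₂ eq
  ... | no ≢m  = inj₁ (s≤s⁻¹ (ℕ.≤∧≢⇒< (Fin.toℕ≤pred[n] s) ≢m))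

  tail-pivot≢ : ∀ {ℓ′} ℓ s {c} → c ≢ priv ℓ → Early ℓ′ c → c ≢ tail ℓ s (pivot ℓ)
  tail-pivot≢ ℓ s c≢ early eq with tail-pivot ℓ s
  ... | inj₁ is-priv = c≢ (trans eq is-priv)
  ... | inj₂ is-tone = tone≢early is-tone early (sym eq)

  -- While one leg still has its private colour at its pivot, the other cannot match it there: off
  -- `j` it shows only its own early colours and tones. Once both have given it up, they agree off
  -- `j` with their leaves, which are distinct.
  mid-mid-other : ∀ ℓ ℓ′ s t → ℓ ≢ ℓ′ → Separated (mid ℓ s) (mid ℓ′ t)
  mid-mid-other ℓ ℓ′ s t ℓ≢ℓ′ =
    [ s-early , (λ s≡m → [ t-early , both-late s≡m ]′ (before-or-at-end t)) ]′ (before-or-at-end s)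
    where
    at-j : tail ℓ (toℕ s) j ≢ tail ℓ′ (toℕ t) j
    at-j eq = early≢priv ℓ≢ℓ′ priv (trans (sym (tail-j ℓ s)) (trans eq (tail-j ℓ′ t)))
    no-edge : ¬ CodeAdj (mid ℓ s) (mid ℓ′ t)
    no-edge = [ ℓ≢ℓ′ ∘ proj₁ , ℓ≢ℓ′ ∘ sym ∘ proj₁ ]′
    foreign : ∀ {ℓ ℓ′} → ℓ ≢ ℓ′ → ∀ s x → x ≢ j → tail ℓ s x ≢ priv ℓ′
    foreign ℓ≢ℓ′ s x x≢j = [ early≢priv ℓ≢ℓ′ , tone≢priv ]′ (tail-others _ s x x≢j)
    s-early : toℕ s ≤ 1 + n₀ → Separated (mid ℓ s) (mid ℓ′ t)
    s-early s≤ = far j (pivot ℓ) (≢-sym (pivot≢j ℓ)) at-j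
      (λ eq → foreign (≢-sym ℓ≢ℓ′) (toℕ t) _ (pivot≢j ℓ) (trans (sym eq) (tail-pivot-before ℓ s≤))) no-edge
    t-early : toℕ t ≤ 1 + n₀ → Separated (mid ℓ s) (mid ℓ′ t)
    t-early t≤ = far j (pivot ℓ′) (≢-sym (pivot≢j ℓ′)) at-j
      (λ eq → foreign ℓ≢ℓ′ (toℕ s) _ (pivot≢j ℓ′) (trans eq (tail-pivot-before ℓ′ t≤))) no-edge
    both-late : toℕ s ≡ 2 + n₀ → toℕ t ≡ 2 + n₀ → Separated (mid ℓ s) (mid ℓ′ t)
    both-late s≡m t≡m with hyperplane-injective (ℓ≢ℓ′ ∘ leaf-injective)
    ... | x , x≢j , differ = far j x (≢-sym x≢j) at-j
      (λ eq → differ (trans (sym (tail-last ℓ s≡m x x≢j)) (trans eq (tail-last ℓ′ t≡m x x≢j)))) no-edge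

  -- At `j` a private colour meets `flat`. The pivot gives a second difference except for the last
  -- `mid` vertex, which agrees with its leaf off `j` and is therefore adjacent to that leaf and to
  -- nothing else in `F`.
  mid-body : ∀ ℓ s y → Separated (mid ℓ s) (body y)
  mid-body ℓ s y = [ inner , outer ]′ (before-or-at-end s)
    where
    at-j : tail ℓ (toℕ s) j ≢ hyperplane y j
    at-j eq with () ← trans (sym (tail-j ℓ s)) (trans eq (hyperplane-j y))
    inner : toℕ s ≤ 1 + n₀ → Separated (mid ℓ s) (body y)
    inner s≤ = far j (pivot ℓ) (≢-sym (pivot≢j ℓ)) at-j
      (λ eq → tone≢priv (hyperplane-tone y _ (pivot≢j ℓ)) (trans (sym eq) (tail-pivot-before ℓ s≤)))
      [ (λ (_ , s≡m) → ℕ.<⇒≢ (s≤s s≤) s≡m) , (λ ()) ]′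
    outer : toℕ s ≡ 2 + n₀ → Separated (mid ℓ s) (body y)
    outer s≡m with Graph._≟ᵛ_ F (leaf ℓ) y
    ... | yes refl = near j at-j (tail-last ℓ s≡m) (inj₁ (refl , s≡m))
    ... | no leaf≢y with hyperplane-injective leaf≢y
    ...   | x , x≢j , differ = far j x (≢-sym x≢j) at-j
      (λ eq → differ (trans (sym (tail-last ℓ s≡m x x≢j)) eq)) [ leaf≢y ∘ proj₁ , (λ ()) ]′

  first-mid-same : ∀ ℓ s → Separated (first ℓ) (mid ℓ s)
  first-mid-same ℓ zero = near (turn ℓ) differ same (inj₁ (refl , refl))
    where
    same : ∀ x → x ≢ turn ℓ → start ℓ x ≡ tail ℓ 0 x
    same x x≢ = trans (turn-only ℓ x x≢) (sym (tail-before ℓ x z≤n))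
    second-turn : turn ℓ ≡ j ⊎ turn ℓ ≡ pivot ℓ → second ℓ (turn ℓ) ≡ priv ℓ
    second-turn (inj₁ eq) = trans (cong (second ℓ) eq) (second-j ℓ)
    second-turn (inj₂ eq) = trans (cong (second ℓ) eq) (second-pivot ℓ)
    differ : start ℓ (turn ℓ) ≢ tail ℓ 0 (turn ℓ)
    differ eq = turn-changes ℓ (trans eq (trans (tail-before ℓ _ z≤n) (second-turn (turn∈ ℓ))))
  first-mid-same ℓ (suc s) = far (changed-at ℓ zero) (turn ℓ) distinct differ₀ (differ (turn∈ ℓ))
      [ (λ ()) , (λ ()) ]′
    where
    x₀ = changed-at ℓ zero
    at-0 : time ℓ x₀ ≡ 0
    at-0 = time-changed-at ℓ zero
    -- With at least three coordinates, the one replaced first is neither `j` nor the pivot: their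
    -- times are `2 + n₀` and `1 + n₀`.
    distinct : changed-at ℓ zero ≢ turn ℓ
    distinct eq with turn∈ ℓ
    ... | inj₁ is-j with () ← trans (sym at-0) (trans (cong (time ℓ) (trans eq is-j)) (time-j ℓ))
    ... | inj₂ is-p with () ← trans (sym at-0) (trans (cong (time ℓ) (trans eq is-p)) (time-pivot ℓ))
    differ₀ : start ℓ (changed-at ℓ zero) ≢ tail ℓ (suc (toℕ s)) (changed-at ℓ zero)
    differ₀ eq = tone≢early
      (hyperplane-tone (leaf ℓ) _ (time<⇒≢j ℓ x₀ (subst (_< 2 + n₀) (sym at-0) (s≤s z≤n)))) (start-early ℓ _)
      (sym (trans eq (tail-after ℓ x₀ (subst (_< suc (toℕ s)) (sym at-0) (s≤s z≤n)))))
    differ : turn ℓ ≡ j ⊎ turn ℓ ≡ pivot ℓ → start ℓ (turn ℓ) ≢ tail ℓ (suc (toℕ s)) (turn ℓ)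
    differ (inj₁ is-j) eq = turn-changes ℓ
      (trans eq (trans (cong (tail ℓ (suc (toℕ s))) is-j) (tail-j ℓ (suc s))))
    differ (inj₂ is-p) eq = tail-pivot≢ ℓ (suc (toℕ s)) (turn-changes ℓ) (start-early ℓ _)
      (trans eq (cong (tail ℓ (suc (toℕ s))) is-p))

  first-mid-other : ∀ ℓ ℓ′ s → ℓ ≢ ℓ′ → Separated (first ℓ) (mid ℓ′ s)
  first-mid-other ℓ ℓ′ s ℓ≢ℓ′ = far j (pivot ℓ′) (≢-sym (pivot≢j ℓ′))
    (λ eq → early≢priv ℓ≢ℓ′ (start-early ℓ j) (trans eq (tail-j ℓ′ s)))
    (tail-pivot≢ ℓ′ (toℕ s) (early≢priv ℓ≢ℓ′ (start-early ℓ _)) (start-early ℓ _))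
    [ ℓ≢ℓ′ ∘ proj₁ , (λ ()) ]′

  first-body : ∀ ℓ y → Separated (first ℓ) (body y)
  first-body ℓ y = far j (pivot ℓ) (≢-sym (pivot≢j ℓ))
    (λ eq → start-j ℓ (trans eq (hyperplane-j y)))
    (λ eq → tone≢early (hyperplane-tone y _ (pivot≢j ℓ)) (start-early ℓ _) (sym eq))
    [ (λ ()) , (λ ()) ]′

  root-mid : ∀ ℓ s → Separated root (mid ℓ s)
  root-mid ℓ s = far j (pivot ℓ) (≢-sym (pivot≢j ℓ)) at-j
    (tail-pivot≢ ℓ (toℕ s) (λ ()) (base {ℓ = ℓ})) [ (λ ()) , (λ ()) ]′
    where
    at-j : base ≢ tail ℓ (toℕ s) j
    at-j eq with () ← trans eq (tail-j ℓ s)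

  root-body : ∀ y → Separated root (body y)
  root-body y = far j (punchIn j zero) (≢-sym (Fin.punchInᵢ≢i j zero)) at-j at-0 [ (λ ()) , (λ ()) ]′
    where
    at-j : base ≢ hyperplane y j
    at-j eq with () ← trans eq (hyperplane-j y)
    at-0 : base ≢ hyperplane y (punchIn j zero)
    at-0 eq with () ← trans eq (hyperplane-punchIn y zero)

  -- The pairs whose adjacency depends on how the legs leave the root.
  data Pending : Code (3 + n₀) L F → Code (3 + n₀) L F → Set where
    root-first  : ∀ ℓ → Pending root (first ℓ)
    first-root  : ∀ ℓ → Pending (first ℓ) root
    first-first : ∀ {ℓ ℓ′} → ℓ ≢ ℓ′ → Pending (first ℓ) (first ℓ′)

  data Status (c d : Code (3 + n₀) L F) : Set where
    same    : c ≡ d → Status c d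
    settled : Separated c d → Status c d
    pending : Pending c d → Status c d

  -- Settles once, for both deletion and addition, every pair that does not depend on the first
  -- steps from the root.
  status : ∀ c d → Status c d
  status root      root      = same refl
  status root      (first ℓ) = pending (root-first ℓ)
  status root      (mid ℓ s) = settled (root-mid ℓ s)
  status root      (body y)  = settled (root-body y)
  status (first ℓ) root      = pending (first-root ℓ)
  status (first ℓ) (first ℓ′) with ℓ ≟ ℓ′
  ... | yes refl = same refl
  ... | no ℓ≢ℓ′  = pending (first-first ℓ≢ℓ′)
  status (first ℓ) (mid ℓ′ s) with ℓ ≟ ℓ′
  ... | yes refl = settled (first-mid-same ℓ s)
  ... | no ℓ≢ℓ′  = settled (first-mid-other ℓ ℓ′ s ℓ≢ℓ′)
  status (first ℓ) (body y)  = settled (first-body ℓ y)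
  status (mid ℓ s) root      = settled (Separated-sym (root-mid ℓ s))
  status (mid ℓ s) (first ℓ′) with ℓ′ ≟ ℓ
  ... | yes refl = settled (Separated-sym (first-mid-same ℓ s))
  ... | no ℓ′≢ℓ  = settled (Separated-sym (first-mid-other ℓ′ ℓ s ℓ′≢ℓ))
  status (mid ℓ s) (mid ℓ′ t) with ℓ ≟ ℓ′
  ... | no ℓ≢ℓ′ = settled (mid-mid-other ℓ ℓ′ s t ℓ≢ℓ′)
  ... | yes refl with ℕ.<-cmp (toℕ s) (toℕ t)
  ...   | tri< s<t _ _ = settled (mid-mid-same ℓ s t s<t)
  ...   | tri≈ _ s≡t _ = same (cong (mid ℓ) (Fin.toℕ-injective s≡t))
  ...   | tri> _ _ t<s = settled (Separated-sym (mid-mid-same ℓ t s t<s))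
  status (mid ℓ s) (body y)  = settled (mid-body ℓ s y)
  status (body y)  root      = settled (Separated-sym (root-body y))
  status (body y)  (first ℓ) = settled (Separated-sym (first-body ℓ y))
  status (body y)  (mid ℓ s) = settled (Separated-sym (mid-body ℓ s y))
  status (body y)  (body z) with Graph._≟ᵛ_ F y z
  ... | yes refl = same refl
  ... | no y≢z with hyperplane-injective y≢z
  ...   | x , _ , differ = settled (separated (x , differ)
            (mk⇔ [ to (hyperplane-adj y z) , to (hyperplane-adj y z) ∘ symm F ]′
                 (inj₁ ∘ from (hyperplane-adj y z))))

-- Legs that leave the root along a coordinate

spike : ∀ {n L κ} → Fin n → Colour L κ → Fin n → Colour L κ
spike d c x with x ≟ d
... | yes _ = c
... | no _  = base

spike-at : ∀ {n L κ} (d : Fin n) (c : Colour L κ) → spike d c d ≡ c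
spike-at d c with d ≟ d
... | yes _  = refl
... | no d≢d = contradiction refl d≢d

spike-off : ∀ {n L κ} (d : Fin n) (c : Colour L κ) {x} → x ≢ d → spike d c x ≡ base
spike-off d c {x} x≢d with x ≟ d
... | yes x≡d = contradiction x≡d x≢d
... | no _    = refl

spike-early : ∀ {n L κ} (d : Fin n) (ℓ : Fin L) x → Early {κ = κ} ℓ (spike d (priv ℓ) x)
spike-early d ℓ x with x ≟ d
... | yes _ = priv
... | no _  = base

spike≢flat : ∀ {n L κ} (d : Fin n) (ℓ : Fin L) x → spike {κ = κ} d (priv ℓ) x ≢ flat
spike≢flat d ℓ x eq with x ≟ d
spike≢flat d ℓ x () | yes _
spike≢flat d ℓ x () | no _

spikes : ∀ {n L κ} → Fin n → Fin n → Colour L κ → Fin n → Colour L κ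
spikes d d′ c x with x ≟ d
... | yes _ = c
... | no _  = spike d′ c x

spikes-left : ∀ {n L κ} (d d′ : Fin n) (c : Colour L κ) → spikes d d′ c d ≡ c
spikes-left d d′ c with d ≟ d
... | yes _  = refl
... | no d≢d = contradiction refl d≢d

spikes-off-left : ∀ {n L κ} (d d′ : Fin n) (c : Colour L κ) {x} → x ≢ d → spikes d d′ c x ≡ spike d′ c x
spikes-off-left d d′ c {x} x≢d with x ≟ d
... | yes x≡d = contradiction x≡d x≢d
... | no _    = refl

spikes-right : ∀ {n L κ} (d d′ : Fin n) (c : Colour L κ) → spikes d d′ c d′ ≡ c
spikes-right d d′ c with d′ ≟ d
... | yes _ = refl
... | no _  = spike-at d′ c

spikes-off-right : ∀ {n L κ} (d d′ : Fin n) (c : Colour L κ) {x} → x ≢ d′ → spikes d d′ c x ≡ spike d c x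
spikes-off-right d d′ c {x} x≢d′ with x ≟ d
... | yes _ = refl
... | no _  = spike-off d′ c x≢d′

spikes-early : ∀ {n L κ} (d d′ : Fin n) (ℓ : Fin L) x → Early {κ = κ} ℓ (spikes d d′ (priv ℓ) x)
spikes-early d d′ ℓ x with x ≟ d
... | yes _ = priv
... | no _  = spike-early d′ ℓ x

base≢priv : ∀ {L κ} {ℓ : Fin L} {c : Colour L κ} → c ≡ base → c ≢ priv ℓ
base≢priv refl ()

-- In both cases `second` carries the private colour exactly at `j` and the pivot. A leg in
-- direction `j` already has it at `j` and borrows `i` as pivot; any other leg takes its own
-- direction as pivot and turns into `j`.
straight-leg : ∀ {n L κ} {j i : Fin n} → i ≢ j → Fin n → (ℓ : Fin L) → Leg κ j ℓ
straight-leg {j = j} {i} i≢j d ℓ with d ≟ j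
... | yes refl = record
  { pivot = i ; pivot≢j = i≢j
  ; start = spike d (priv ℓ) ; second = spikes d i (priv ℓ)
  ; start-early = spike-early d ℓ ; start-j = spike≢flat d ℓ d
  ; second-early = spikes-early d i ℓ
  ; second-j = spikes-left d i _ ; second-pivot = spikes-right d i _
  ; turn = i ; turn∈ = inj₂ refl
  ; turn-changes = base≢priv (spike-off d _ i≢j)
  ; turn-only = λ x x≢i → sym (spikes-off-right d i _ x≢i)
  }
... | no d≢j = record
  { pivot = d ; pivot≢j = d≢j
  ; start = spike d (priv ℓ) ; second = spikes j d (priv ℓ)
  ; start-early = spike-early d ℓ ; start-j = spike≢flat d ℓ j
  ; second-early = spikes-early j d ℓ
  ; second-j = spikes-left j d _ ; second-pivot = spikes-right j d _
  ; turn = j ; turn∈ = inj₁ refl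
  ; turn-changes = base≢priv (spike-off d _ (≢-sym d≢j))
  ; turn-only = λ x x≢j → sym (spikes-off-left j d _ x≢j)
  }

straight-start : ∀ {n L κ} {j i : Fin n} (i≢j : i ≢ j) d (ℓ : Fin L) →
                 Leg.start (straight-leg {κ = κ} i≢j d ℓ) ≡ spike d (priv ℓ)
straight-start {j = j} i≢j d ℓ with d ≟ j
... | yes refl = refl
... | no _     = refl

-- From colour tuples to vertices of the Hamming graph

module Painting {n L κ k : ℕ} (σ : Fin n → Colour L κ → Fin k)
  (σ-injective : ∀ x {a b} → σ x a ≡ σ x b → a ≡ b) where

  painted : (Fin n → Colour L κ) → Vec (Fin k) n
  painted f = tabulate λ x → σ x (f x)

  lookup-painted : ∀ f x → lookup (painted f) x ≡ σ x (f x)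
  lookup-painted f = lookup∘tabulate λ x → σ x (f x)

  painted-cancel : ∀ f g x → lookup (painted f) x ≡ lookup (painted g) x → f x ≡ g x
  painted-cancel f g x eq =
    σ-injective x (trans (sym (lookup-painted f x)) (trans eq (lookup-painted g x)))

  painted-cong : ∀ f g x → f x ≡ g x → lookup (painted f) x ≡ lookup (painted g) x
  painted-cong f g x eq = trans (lookup-painted f x) (trans (cong (σ x) eq) (sym (lookup-painted g x)))

  painted-apart : ∀ f g → Apart f g → painted f ≢ painted g
  painted-apart f g (x , differ) eq = differ (painted-cancel f g x (cong (λ u → lookup u x) eq))

  -- Colourings that are injective in every coordinate preserve the set of coordinates in which two
  -- tuples differ, even if they vary with the coordinate.
  painted-adj : ∀ f g → DiffOne f g ⇔ DifferInOne (painted f) (painted g)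
  painted-adj f g = mk⇔ (diffOne-map (λ x → _∘ painted-cancel f g x) (λ x → _∘ painted-cong f g x))
                        (diffOne-map (λ x → _∘ painted-cong f g x) (λ x → _∘ painted-cancel f g x))

-- No difference would mean equality and a single one adjacency. The two coordinates become `j` and
-- `i` when an edge is added.
≢-hamming : ∀ {A : Set} {n} → DecidableEquality A → (u v : Vec A n) → u ≢ v → ¬ DifferInOne u v →
            ∃ λ x → ∃ λ y → x ≢ y × lookup u x ≢ lookup v x × lookup u y ≢ lookup v y
≢-hamming _≟ᴬ_ u v u≢v ¬one with any? (λ x → ¬? (lookup u x ≟ᴬ lookup v x))
... | no agree = contradiction (lookup-ext λ x → decidable-stable (_ ≟ᴬ _) λ d → agree (x , d)) u≢v
... | yes (x , dx) with any? (λ y → ¬? (x ≟ y) ×-dec ¬? (lookup u y ≟ᴬ lookup v y))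
...   | yes (y , x≢y , dy) = x , y , x≢y , dx , dy
...   | no none = contradiction (diffOne-at x dx λ y y≢x →
          decidable-stable (_ ≟ᴬ _) λ dy → none (y , ≢-sym y≢x , dy)) ¬one

cancel-pair : ∀ {A B : Set} {e : A → B} → Injective _≡_ _≡_ e → ∀ x y u v →
              SamePair (e x) (e y) (e u) (e v) → SamePair x y u v
cancel-pair inj x y u v (inj₁ (p , q)) = inj₁ (inj p , inj q)
cancel-pair inj x y u v (inj₂ (p , q)) = inj₂ (inj p , inj q)

-- Copies of H after deletion or addition of an edge

module Saturation {n₀ κ : ℕ} {H F T : Graph}
  (spider : IsBalancedSpider (4 + n₀) (5 + n₀) T) (union : IsUnion F T (IsLeaf T) H)
  (place : F ⊆ᴵ □^ (2 + n₀) K κ) where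
  open Decoding {2 + n₀} {2 + n₀} spider union

  n L k : ℕ
  n = 3 + n₀
  L = 4 + n₀
  k = 2 + (L + κ)

  Γ : Graph
  Γ = □^ n K k

  CodeH : Set
  CodeH = Code n L F

  -- Legs `zero` and `suc d` both leave the root in direction `d`. Their first vertices become `u`
  -- and `v`, the root a third vertex of the same line. The deleted edge was the only adjacency
  -- between first vertices.
  deletion : ∀ u v (uv : Adj Γ u v) → H ⊆ᴵ deleteEdge Γ u v uv
  deletion u v uv@(d , differ , unique) = induced-by-codes e faithful
    where
    -- Any coordinate other than `d` serves; `d` itself is then the pivot of the leg in direction
    -- `j`.
    j : Fin n
    j = punchIn d zero
    d≢j : d ≢ j
    d≢j = ≢-sym (Fin.punchInᵢ≢i d zero)
    direction : Fin L → Fin n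
    direction zero    = d
    direction (suc i) = i
    open Layout leaf leaf-injective place j (λ ℓ → straight-leg d≢j (direction ℓ) ℓ)

    start-spike : ∀ ℓ x → position (first ℓ) x ≡ spike (direction ℓ) (priv ℓ) x
    start-spike ℓ x = cong (_$ x) (straight-start d≢j (direction ℓ) ℓ)

    -- At `d` the private colours of legs `zero` and `suc d` go to the entries of `u` and `v`.
    -- Elsewhere both legs start with `base`, and `u` and `v` agree.
    colouring : ∀ x → ∃ λ (σ : Colour L κ → Fin k) → (∀ {a b} → σ a ≡ σ b → a ≡ b) ×
      (∀ ℓ w → (ℓ ≡ zero × w ≡ u) ⊎ (ℓ ≡ suc d × w ≡ v) → σ (spike d (priv ℓ) x) ≡ lookup w x)
    colouring x with x ≟ d
    ... | yes refl with paint {L} {κ} {priv zero} {priv (suc d)} (λ ()) differ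
    ...   | σ , inj , to-u , to-v = σ , inj , λ
            { _ _ (inj₁ (refl , refl)) → to-u
            ; _ _ (inj₂ (refl , refl)) → to-v }
    colouring x | no x≢d with paint-base {L} {κ} (lookup u x)
    ...   | σ , inj , to-u = σ , inj , λ
            { _ _ (inj₁ (_ , refl)) → to-u
            ; _ _ (inj₂ (_ , refl)) → trans to-u
                (decidable-stable (_ ≟ _) λ dx → x≢d (sym (unique dx))) }

    open Painting (λ x → proj₁ (colouring x)) (λ x → proj₁ (proj₂ (colouring x)))

    e : CodeH → Vec (Fin k) n
    e c = painted (position c)

    e-end : ∀ ℓ w → direction ℓ ≡ d → (ℓ ≡ zero × w ≡ u) ⊎ (ℓ ≡ suc d × w ≡ v) → e (first ℓ) ≡ w
    e-end ℓ w to-d end = lookup-ext λ x → trans (lookup-painted (position (first ℓ)) x)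
      (trans (cong (proj₁ (colouring x)) (trans (start-spike ℓ x) (cong (λ d → spike d (priv ℓ) x) to-d)))
             (proj₂ (proj₂ (colouring x)) ℓ w end))

    e-u : e (first zero) ≡ u
    e-u = e-end zero u refl (inj₁ (refl , refl))

    e-v : e (first (suc d)) ≡ v
    e-v = e-end (suc d) v refl (inj₂ (refl , refl))

    start-at : ∀ ℓ → position (first ℓ) (direction ℓ) ≡ priv ℓ
    start-at ℓ = trans (start-spike ℓ _) (spike-at (direction ℓ) _)

    first-first-apart : ∀ {ℓ ℓ′} → ℓ ≢ ℓ′ → position (first ℓ) (direction ℓ) ≢ position (first ℓ′) (direction ℓ)
    first-first-apart {ℓ} {ℓ′} ℓ≢ℓ′ eq = early≢priv (≢-sym ℓ≢ℓ′) (spike-early (direction ℓ′) ℓ′ (direction ℓ))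
      (trans (sym (start-spike ℓ′ _)) (trans (sym eq) (start-at ℓ)))

    root-first-near : ∀ ℓ → Separated root (first ℓ)
    root-first-near ℓ = near (direction ℓ) (λ eq → base≢priv (sym eq) (start-at ℓ))
      (λ x x≢ → sym (trans (start-spike ℓ x) (spike-off _ _ x≢))) (inj₁ tt)

    first-first-far : ∀ {ℓ ℓ′} → ℓ ≢ ℓ′ → direction ℓ ≢ direction ℓ′ → Separated (first ℓ) (first ℓ′)
    first-first-far {ℓ} {ℓ′} ℓ≢ℓ′ d≢d′ = far (direction ℓ) (direction ℓ′) d≢d′
      (first-first-apart ℓ≢ℓ′) (≢-sym (first-first-apart (≢-sym ℓ≢ℓ′))) [ (λ ()) , (λ ()) ]′

    apart-or-same : ∀ {c c′} → Status c c′ → c ≡ c′ ⊎ Apart (position c) (position c′)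
    apart-or-same (same eq)                    = inj₁ eq
    apart-or-same (settled sep)                = inj₂ (apart sep)
    apart-or-same (pending (root-first ℓ))     = inj₂ (apart (root-first-near ℓ))
    apart-or-same (pending (first-root ℓ))     = inj₂ (apart (Separated-sym (root-first-near ℓ)))
    apart-or-same (pending (first-first ℓ≢ℓ′)) = inj₂ (_ , first-first-apart ℓ≢ℓ′)

    e-injective : Injective _≡_ _≡_ e
    e-injective {c} {c′} eq =
      [ id , ⊥-elim ∘ (_$ eq) ∘ painted-apart (position c) (position c′) ]′
      (apart-or-same (status c c′))

    Faithful : CodeH → CodeH → Set
    Faithful c c′ = c ≡ c′ ⊎ (e c ≢ e c′ × (CodeAdj c c′ ⇔ Adj (deleteEdge Γ u v uv) (e c) (e c′)))

    -- By injectivity only `first zero` and `first (suc d)` are mapped to `u` and `v`, and these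
    -- codes are not adjacent.
    kept : ∀ c c′ → CodeAdj c c′ → ¬ SamePair (e c) (e c′) u v
    kept c c′ adj pair
      with cancel-pair e-injective c c′ (first zero) (first (suc d)) (subst₂ (SamePair (e c) (e c′)) (sym e-u) (sym e-v) pair)
    ... | inj₁ (refl , refl) = [ (λ ()) , (λ ()) ]′ adj
    ... | inj₂ (refl , refl) = [ (λ ()) , (λ ()) ]′ adj

    from-separated : ∀ c c′ → Separated c c′ → Faithful c c′
    from-separated c c′ (separated apart adj) = inj₂
      ( painted-apart (position c) (position c′) apart
      , mk⇔ (λ cc′ → to (painted-adj (position c) (position c′)) (to adj cc′) , kept c c′ cc′)
            (from adj ∘ from (painted-adj (position c) (position c′)) ∘ proj₁))

    removed : ∀ {ℓ ℓ′} → ℓ ≢ ℓ′ → SamePair (e (first ℓ)) (e (first ℓ′)) u v → Faithful (first ℓ) (first ℓ′)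
    removed {ℓ} {ℓ′} ℓ≢ℓ′ pair = inj₂
      ( painted-apart (position (first ℓ)) (position (first ℓ′)) (_ , first-first-apart ℓ≢ℓ′)
      , mk⇔ (⊥-elim ∘ [ (λ ()) , (λ ()) ]′) (λ (_ , other) → contradiction pair other))

    first-first-faithful : ∀ ℓ ℓ′ → ℓ ≢ ℓ′ → Faithful (first ℓ) (first ℓ′)
    first-first-faithful ℓ ℓ′ ℓ≢ℓ′ with direction ℓ ≟ direction ℓ′
    ... | no d≢d′ = from-separated (first ℓ) (first ℓ′) (first-first-far ℓ≢ℓ′ d≢d′)
    -- Distinct legs share a direction only if they are `zero` and `suc d`, and then the edge
    -- between their first vertices is the deleted one.
    first-first-faithful zero    zero     ℓ≢ℓ′ | yes _    = contradiction refl ℓ≢ℓ′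
    first-first-faithful zero    (suc .d) ℓ≢ℓ′ | yes refl = removed ℓ≢ℓ′ (inj₁ (e-u , e-v))
    first-first-faithful (suc .d) zero    ℓ≢ℓ′ | yes refl = removed ℓ≢ℓ′ (inj₂ (e-v , e-u))
    first-first-faithful (suc i) (suc .i) ℓ≢ℓ′ | yes refl = contradiction refl ℓ≢ℓ′

    judge : ∀ {c c′} → Status c c′ → Faithful c c′
    judge (same eq)                    = inj₁ eq
    judge {c} {c′} (settled sep)       = from-separated c c′ sep
    judge (pending (root-first ℓ))     = from-separated root (first ℓ) (root-first-near ℓ)
    judge (pending (first-root ℓ))     = from-separated (first ℓ) root (Separated-sym (root-first-near ℓ))
    judge (pending (first-first ℓ≢ℓ′)) = first-first-faithful _ _ ℓ≢ℓ′

    faithful : ∀ c c′ → Faithful c c′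
    faithful c c′ = judge (status c c′)

  -- The root becomes `u` and `first zero` becomes `v`, so the new edge is the first edge of leg
  -- `zero`. The other `n` legs leave in the `n` directions.
  addition : ∀ u v (uv : Adj (complement Γ) u v) → H ⊆ᴵ addEdge Γ u v uv
  addition u v uv@(u≢v , ¬adj) with ≢-hamming _≟_ u v u≢v ¬adj
  ... | j , i , j≢i , differ-j , differ-i = induced-by-codes e faithful
    where
    i≢j : i ≢ j
    i≢j = ≢-sym j≢i

    -- v⁺ follows v on its leg; flat marks the coordinate i in which they differ.
    v-colour v⁺-colour : Fin n → Colour L κ
    v-colour x with lookup u x ≟ lookup v x | x ≟ i
    ... | yes _ | _     = base
    ... | no _  | yes _ = flat
    ... | no _  | no _  = priv zero
    v⁺-colour x with lookup u x ≟ lookup v x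
    ... | yes _ = base
    ... | no _  = priv zero

    v-early : ∀ x → Early zero (v-colour x)
    v-early x with lookup u x ≟ lookup v x | x ≟ i
    ... | yes _ | _     = base
    ... | no _  | yes _ = flat
    ... | no _  | no _  = priv

    v⁺-early : ∀ x → Early zero (v⁺-colour x)
    v⁺-early x with lookup u x ≟ lookup v x
    ... | yes _ = base
    ... | no _  = priv

    v⁺-differ : ∀ x → lookup u x ≢ lookup v x → v⁺-colour x ≡ priv zero
    v⁺-differ x differ with lookup u x ≟ lookup v x
    ... | yes eq = contradiction eq differ
    ... | no _   = refl

    v-v⁺ : ∀ x → x ≢ i → v-colour x ≡ v⁺-colour x
    v-v⁺ x x≢i with lookup u x ≟ lookup v x | x ≟ i
    ... | yes _ | _       = refl
    ... | no _  | yes x≡i = contradiction x≡i x≢i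
    ... | no _  | no _    = refl

    v-i : v-colour i ≡ flat
    v-i with lookup u i ≟ lookup v i | i ≟ i
    ... | yes eq | _      = contradiction eq differ-i
    ... | no _   | yes _  = refl
    ... | no _   | no i≢i = contradiction refl i≢i

    v-j : v-colour j ≡ priv zero
    v-j = trans (v-v⁺ j j≢i) (v⁺-differ j differ-j)

    legs : ∀ ℓ → Leg κ j ℓ
    legs zero = record
      { pivot = i ; pivot≢j = i≢j
      ; start = v-colour ; second = v⁺-colour
      ; start-early = v-early ; start-j = λ eq → case trans (sym eq) v-j of λ ()
      ; second-early = v⁺-early
      ; second-j = v⁺-differ j differ-j ; second-pivot = v⁺-differ i differ-i
      ; turn = i ; turn∈ = inj₂ refl
      ; turn-changes = λ eq → case trans (sym v-i) eq of λ ()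
      ; turn-only = v-v⁺
      }
    legs (suc d) = straight-leg i≢j d (suc d)

    open Layout leaf leaf-injective place j legs

    start-spike : ∀ d x → position (first (suc d)) x ≡ spike d (priv (suc d)) x
    start-spike d x = cong (_$ x) (straight-start i≢j d (suc d))

    start-at : ∀ d → position (first (suc d)) d ≡ priv (suc d)
    start-at d = trans (start-spike d d) (spike-at d _)

    colouring : ∀ x → ∃ λ (σ : Colour L κ → Fin k) → (∀ {a b} → σ a ≡ σ b → a ≡ b) ×
      σ base ≡ lookup u x × σ (v-colour x) ≡ lookup v x
    -- Where `u` and `v` differ, `v-colour` is not `base`, so two values can be prescribed. Where
    -- they agree, it is `base` and one value serves for both.
    colouring x with lookup u x ≟ lookup v x | x ≟ i
    ... | no differ | yes _ = paint {L} {κ} {base} {flat} (λ ()) differ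
    ... | no differ | no _  = paint {L} {κ} {base} {priv zero} (λ ()) differ
    ... | yes eq    | _ with paint-base {L} {κ} (lookup u x)
    ...   | σ , inj , to-u = σ , inj , to-u , trans to-u eq

    open Painting (λ x → proj₁ (colouring x)) (λ x → proj₁ (proj₂ (colouring x)))

    e : CodeH → Vec (Fin k) n
    e c = painted (position c)

    e-u : e root ≡ u
    e-u = lookup-ext λ x → trans (lookup-painted (position root) x) (proj₁ (proj₂ (proj₂ (colouring x))))

    e-v : e (first zero) ≡ v
    e-v = lookup-ext λ x → trans (lookup-painted (position (first zero)) x) (proj₂ (proj₂ (proj₂ (colouring x))))

    root-v-apart : Apart (position root) (position (first zero))
    root-v-apart = j , λ eq → case trans eq v-j of λ ()

    root-first-near : ∀ d → Separated root (first (suc d))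
    root-first-near d = near d (λ eq → base≢priv (sym eq) (start-at d))
      (λ x x≢ → sym (trans (start-spike d x) (spike-off _ _ x≢))) (inj₁ tt)

    -- The vertex for `v` has the private colour of leg `zero` at `j` and `flat` at `i`; a straight
    -- leg starts with neither colour anywhere.
    v-first-far : ∀ d → Separated (first zero) (first (suc d))
    v-first-far d = far j i j≢i at-j at-i [ (λ ()) , (λ ()) ]′
      where
      at-j : v-colour j ≢ position (first (suc d)) j
      at-j eq = early≢priv (λ ()) (spike-early d (suc d) j) (trans (sym (start-spike d j)) (trans (sym eq) v-j))
      at-i : v-colour i ≢ position (first (suc d)) i
      at-i eq = spike≢flat d (suc d) i (trans (sym (start-spike d i)) (trans (sym eq) v-i))

    straight-far : ∀ {d d′} → d ≢ d′ → Separated (first (suc d)) (first (suc d′))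
    straight-far {d} {d′} d≢d′ = far d d′ d≢d′
      (λ eq → base≢priv (trans eq (trans (start-spike d′ d) (spike-off d′ _ d≢d′))) (start-at d))
      (λ eq → base≢priv (trans (sym eq) (trans (start-spike d d′) (spike-off d _ (≢-sym d≢d′)))) (start-at d′))
      [ (λ ()) , (λ ()) ]′

    first-first-far : ∀ ℓ ℓ′ → ℓ ≢ ℓ′ → Separated (first ℓ) (first ℓ′)
    first-first-far zero    zero     ℓ≢ℓ′ = contradiction refl ℓ≢ℓ′
    first-first-far zero    (suc d)  ℓ≢ℓ′ = v-first-far d
    first-first-far (suc d) zero     ℓ≢ℓ′ = Separated-sym (v-first-far d)
    first-first-far (suc d) (suc d′) ℓ≢ℓ′ = straight-far (ℓ≢ℓ′ ∘ cong suc)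

    apart-or-same : ∀ {c c′} → Status c c′ → c ≡ c′ ⊎ Apart (position c) (position c′)
    apart-or-same (same eq)                      = inj₁ eq
    apart-or-same (settled sep)                  = inj₂ (apart sep)
    apart-or-same (pending (root-first zero))    = inj₂ root-v-apart
    apart-or-same (pending (root-first (suc d))) = inj₂ (apart (root-first-near d))
    apart-or-same (pending (first-root zero))    = inj₂ (_ , ≢-sym (proj₂ root-v-apart))
    apart-or-same (pending (first-root (suc d))) = inj₂ (apart (Separated-sym (root-first-near d)))
    apart-or-same (pending (first-first ℓ≢ℓ′))   = inj₂ (apart (first-first-far _ _ ℓ≢ℓ′))

    e-injective : Injective _≡_ _≡_ e
    e-injective {c} {c′} eq =
      [ id , ⊥-elim ∘ (_$ eq) ∘ painted-apart (position c) (position c′) ]′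
      (apart-or-same (status c c′))

    Faithful : CodeH → CodeH → Set
    Faithful c c′ = c ≡ c′ ⊎ (e c ≢ e c′ × (CodeAdj c c′ ⇔ Adj (addEdge Γ u v uv) (e c) (e c′)))

    -- By injectivity only `root` and `first zero` are mapped to `u` and `v`, and these codes are
    -- adjacent.
    new-edge : ∀ c c′ → SamePair (e c) (e c′) u v → CodeAdj c c′
    new-edge c c′ pair
      with cancel-pair e-injective c c′ root (first zero) (subst₂ (SamePair (e c) (e c′)) (sym e-u) (sym e-v) pair)
    ... | inj₁ (refl , refl) = inj₁ tt
    ... | inj₂ (refl , refl) = inj₂ tt

    from-separated : ∀ c c′ → Separated c c′ → Faithful c c′
    from-separated c c′ (separated apart adj) = inj₂
      ( painted-apart (position c) (position c′) apart
      , mk⇔ (inj₁ ∘ to (painted-adj (position c) (position c′)) ∘ to adj)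
            [ from adj ∘ from (painted-adj (position c) (position c′)) , new-edge c c′ ]′)

    judge : ∀ {c c′} → Status c c′ → Faithful c c′
    judge (same eq)                             = inj₁ eq
    judge {c} {c′} (settled sep)                = from-separated c c′ sep
    judge (pending (root-first zero))           = inj₂
      ( painted-apart (position root) (position (first zero)) root-v-apart
      , mk⇔ (λ _ → inj₂ (inj₁ (e-u , e-v))) (λ _ → inj₁ tt))
    judge (pending (root-first (suc d)))        = from-separated root (first (suc d)) (root-first-near d)
    judge (pending (first-root zero))           = inj₂
      ( ≢-sym (painted-apart (position root) (position (first zero)) root-v-apart)
      , mk⇔ (λ _ → inj₂ (inj₂ (e-v , e-u))) (λ _ → inj₂ tt))
    judge (pending (first-root (suc d)))        = from-separated (first (suc d)) root (Separated-sym (root-first-near d))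
    judge {c} {c′} (pending (first-first ℓ≢ℓ′)) = from-separated c c′ (first-first-far _ _ ℓ≢ℓ′)

    faithful : ∀ c c′ → Faithful c c′
    faithful c c′ = judge (status c c′)

  saturated : InducedSaturated H Γ
  saturated = record
    { nontrivial = ℕ.≤-trans (s≤s (s≤s z≤n)) (ℕ.m≤m*n k (k ^ (2 + n₀)) ⦃ ℕ.m^n≢0 k (2 + n₀) ⦄)
    ; avoids     = avoids-hamming ℕ.≤-refl
    ; deletion   = deletion
    ; addition   = addition
    }

-- Raising the dimension of F, and the conclusion

raise-dimension : ∀ {F d d′ κ} → κ ≥ 1 → F ⊆ᴵ □^ d K κ → d ≤′ d′ → F ⊆ᴵ □^ d′ K κ
raise-dimension κ≥1 place (≤′-reflexive refl) = place
raise-dimension {F} {κ = suc κ} κ≥1 place (≤′-step {d′} d≤d′) = record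
  -- The layout wants `F` in dimension exactly `n - 1`, while its own dimension may be smaller. A
  -- constant new coordinate changes no adjacency, and `κ ≥ 1` supplies its entry.
  { embed     = λ y → zero ∷ embed y
  ; injective = injective ∘ proj₂ ∘ ∷-injective
  ; induced   = λ y z → mk⇔ (there ∘ to (induced y z)) (from (induced y z) ∘ back)
  }
  where
  open _⊆ᴵ_ (raise-dimension (s≤s z≤n) place d≤d′)
  there : ∀ {u v : Vec (Fin (suc κ)) d′} → DifferInOne u v → DifferInOne (zero ∷ u) (zero ∷ v)
  there (x , differ , unique) = suc x , differ , λ
    { {zero}  d → contradiction refl d
    ; {suc y} d → cong suc (unique d) }
  back : ∀ {u v : Vec (Fin (suc κ)) d′} → DifferInOne (zero ∷ u) (zero ∷ v) → DifferInOne u v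
  back (zero  , differ , _)      = contradiction refl differ
  back (suc x , differ , unique) = x , differ , λ d → Fin.suc-injective (unique d)

theoremB : (n : ℕ) → n ≥ 3 → (H : Graph) → 𝓕 n H →
    ∃ λ k → k ≥ 1 × InducedSaturated H (□^ n K k)
theoremB (suc (suc (suc n₀))) (s≤s (s≤s (s≤s _))) H class
  with 𝓕.F-dim class | 𝓕.T-spider class
... | d , ((κ , κ≥1 , place) , _) , d≤n-1 | spider
  rewrite ℕ.+-comm n₀ 1 | ℕ.+-comm n₀ 2 =
  k , s≤s z≤n , saturated
  where open Saturation spider (𝓕.union class) (raise-dimension κ≥1 place (≤⇒≤′ d≤n-1))
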